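{- There is a constant $c_1>0$ such that for all $n>5$, $$h_3(n,\{(4,0),(4,3)\}) > c_1\, n^{1/3}.$$ That is, every $n$-vertex $3$-graph in which every four vertices span $1$, $2$ or $4$ edges has a clique or coclique of size greater than $c_1 n^{1/3}$.
   Context: For an $r$-uniform hypergraph ($r$-graph) $H$, a homogeneous set is a set of vertices that is either a clique (every $r$-subset is an edge) or a coclique (no $r$-subset is an edge); $h(H)$ denotes the size of a largest homogeneous set. An $(m,f)$-graph is an $r$-graph with $m$ vertices and $f$ edges; $H$ is $(m,f)$-free if it contains no induced sub-hypergraph that is an $(m,f)$-graph. For a set $Q$ of pairs $(m,f)$, $H$ is $Q$-free if it is $(m,f)$-free for every $(m,f)\in Q$. $h_r(n,Q)$ is the minimum of $h(H)$ over all $n$-vertex $Q$-free $r$-graphs $H$. -}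

module Defs where

open import Data.Fin.Subset using (Subset; _⊆_; ∣_∣)
open import Data.Fin.Subset.Properties using (_⊆?_)
open import Data.Integer.Base using (+_)
open import Data.List.Base using (List; filter; length)
open import Data.List.Membership.Propositional using (_∈_; _∉_)
open import Data.List.Relation.Unary.All using (All)
open import Data.List.Relation.Unary.Unique.Propositional using (Unique)
open import Data.Nat.Base using (ℕ; _≤_)
open import Data.Product.Base using (_×_; _,_; ∃-syntax)
open import Data.Rational.Base using (ℚ; _/_; _*_; _<_)
open import Data.Sum.Base using (_⊎_)
open import Level using (0ℓ)
open import Relation.Binary.PropositionalEquality.Core using (_≡_)
open import Relation.Nullary.Negation.Core using (¬_)
open import Relation.Unary using (Pred)

-- The vertex set is Fin n.  The finite edge set is a repetition-free list, so
-- that its length is its cardinality; the order of the list plays no role.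
record Hypergraph (r n : ℕ) : Set where
  field
    edges   : List (Subset n)
    unique  : Unique edges
    uniform : All (λ e → ∣ e ∣ ≡ r) edges

open Hypergraph public

module _ {r n : ℕ} (H : Hypergraph r n) where

  inducedEdges : Subset n → List (Subset n)
  inducedEdges W = filter (_⊆? W) (edges H)

  Clique : Pred (Subset n) 0ℓ
  Clique S = ∀ e → ∣ e ∣ ≡ r → e ⊆ S → e ∈ edges H

  Coclique : Pred (Subset n) 0ℓ
  Coclique S = ∀ e → ∣ e ∣ ≡ r → e ⊆ S → e ∉ edges H

  Homogeneous : Pred (Subset n) 0ℓ
  Homogeneous S = Clique S ⊎ Coclique S

  ContainsInduced : ℕ × ℕ → Set
  ContainsInduced (m , f) =
    ∃[ W ] ∣ W ∣ ≡ m × length (inducedEdges W) ≡ f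

  Free : Pred (ℕ × ℕ) 0ℓ → Set
  Free Q = ∀ q → Q q → ¬ ContainsInduced q

IsGreatest : Pred ℕ 0ℓ → Pred ℕ 0ℓ
IsGreatest P k = P k × (∀ j → P j → j ≤ k)

IsLeast : Pred ℕ 0ℓ → Pred ℕ 0ℓ
IsLeast P k = P k × (∀ j → P j → k ≤ j)

-- Is-h H k means h(H) = k.
Is-h : ∀ {r n} → Hypergraph r n → Pred ℕ 0ℓ
Is-h H = IsGreatest (λ s → ∃[ S ] Homogeneous H S × ∣ S ∣ ≡ s)

-- Is-hᵣ r n Q k means h_r(n,Q) = k.  It is a relation because the minimum does
-- not exist when there is no Q-free r-graph on n vertices.
Is-hᵣ : (r n : ℕ) → Pred (ℕ × ℕ) 0ℓ → Pred ℕ 0ℓ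
Is-hᵣ r n Q = IsLeast (λ k → ∃[ H ] Free {r} {n} H Q × Is-h H k)

-- k > c · n^(1/3), expressed without real numbers by cubing both sides
-- (cubing is strictly increasing): c³ · n < k³.
infix 4 _>_·∛_
_>_·∛_ : ℕ → ℚ → ℕ → Set
k > c ·∛ n = (c * c * c) * ι n < ι k * ι k * ι k
  where
  ι : ℕ → ℚ
  ι a = + a / 1

-- Fix a vertex v and join x and y when vxy is not an edge.  The four-vertex
-- condition makes this graph on the other vertices 2K₂-free, and both its
-- cliques and its independent sets are cliques of the hypergraph.  By
-- Wagon's argument a 2K₂-free graph with all homogeneous sets of size at most k
-- has at most k³ vertices: relative to a maximum clique A, the common
-- non-neighbours of two vertices of A are independent, and so are the vertices
-- with exactly one non-neighbour in A, for each choice of that non-neighbour;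
-- by maximality these sets cover everything.  The minimum defining h₃(n,Q)
-- exists because there are finitely many hypergraphs up to the order of edges
-- and the complete one is Q-free.
module Submission where

open import Defs
open import Data.Nat.Base using (_>_)
open import Data.Product.Base using (_×_; _,_; ∃-syntax)
open import Data.Rational.Base using (ℚ; 0ℚ) renaming (_>_ to _>ℚ_)
open import Relation.Unary using (｛_｝; _∪_)

import Data.Bool.Properties as Bool
open import Data.Empty using () renaming (⊥ to Absurd)
open import Data.Fin.Base using (Fin; zero; suc)
open import Data.Fin.Properties using (any?; all?; suc-injective; 0≢1+n) renaming (_≟_ to _≟ᶠ_)
open import Data.Fin.Subset using (Subset; inside; outside; _∈_; _∉_; _⊆_; ∣_∣; ⁅_⁆; ⊥; ⊤; ∁; _∩_)
  renaming (_∪_ to _∪ˢ_)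
open import Data.Fin.Subset.Properties
  using ( _∈?_; _⊆?_; anySubset?; ∉⊥; ∣⊥∣≡0; ∣⊤∣≡n; ∣p∣≤n; x∈⁅x⁆; x∈⁅y⁆⇒x≡y; ∣⁅x⁆∣≡1
        ; ⊆-antisym; p⊆q⇒∣p∣≤∣q∣; p⊂q⇒∣p∣<∣q∣; x∈p∪q⁺; x∈p∪q⁻; x∈p∩q⁺; x∈p∩q⁻; p∩q⊆p
        ; x∈∁p⇒x∉p; x∉p⇒x∈∁p; ∪-identityˡ)
import Data.Integer.Base as ℤ
import Data.Integer.Properties as ℤ
open import Data.List.Base using (List; []; _∷_; [_]; _++_; map; foldr; filter; length)
open import Data.List.Membership.DecPropositional using () renaming (_∈?_ to ∈ˡ?)
open import Data.List.Membership.Propositional using (lose) renaming (_∈_ to _∈ˡ_; _∉_ to _∉ˡ_)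
open import Data.List.Membership.Propositional.Properties
  using (∈-map⁺; ∈-map⁻; ∈-++⁺ˡ; ∈-++⁺ʳ; ∈-filter⁺; ∈-filter⁻)
open import Data.List.Membership.Propositional.Properties.WithK using (unique∧set⇒bag)
open import Data.List.Properties using (filter-reject; filter-all)
open import Data.List.Relation.Binary.BagAndSetEquality using (∼bag⇒↭)
open import Data.List.Relation.Binary.Permutation.Propositional using (_↭_; refl; prep; swap; ↭-trans; ↭-sym)
open import Data.List.Relation.Binary.Permutation.Propositional.Properties
  using (↭-length; filter-↭; ∈-resp-↭)
open import Data.List.Relation.Unary.All using (All; []; _∷_)
import Data.List.Relation.Unary.All as All
import Data.List.Relation.Unary.All.Properties as All
open import Data.List.Relation.Unary.AllPairs using ([]; _∷_)
open import Data.List.Relation.Unary.Any using (Any; here; there)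
import Data.List.Relation.Unary.Any as Any
open import Data.List.Relation.Unary.Unique.Propositional using (Unique)
open import Data.List.Relation.Unary.Unique.DecPropositional using (unique?)
import Data.List.Relation.Unary.Unique.Propositional.Properties as Unique
open import Data.Nat.Base using (ℕ; zero; suc; _+_; _*_; _≤_; _<_; z≤n; s≤s)
import Data.Nat.Properties as ℕ
open import Data.Product.Base using (∃; proj₁; proj₂)
open import Data.Rational.Base using (½; toℚᵘ)
import Data.Rational.Base as ℚ
import Data.Rational.Properties as ℚ
import Data.Rational.Unnormalised.Base as ℚᵘ
import Data.Rational.Unnormalised.Properties as ℚᵘ
open import Data.Sum.Base using (inj₁; inj₂; [_,_]′)
open import Data.Vec.Base using ([]; _∷_; tabulate; here; there)
open import Data.Vec.Properties using (lookup∘tabulate; lookup⇒[]=; []=⇒lookup)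
  renaming (≡-dec to Vec-≡-dec; ∷-injectiveʳ to Vec-∷-injectiveʳ)
open import Function.Base using (_∘_; case_of_)
open import Function.Bundles using (mk⇔)
open import Level using (0ℓ)
open import Relation.Binary.Core using (Rel)
open import Relation.Binary.Definitions using (Symmetric; DecidableEquality)
  renaming (Decidable to Decidable₂)
open import Relation.Binary.PropositionalEquality
  using (_≡_; _≢_; refl; sym; trans; cong; subst; ≢-sym; module ≡-Reasoning)
open import Relation.Nullary using (¬_; Dec; yes; no; does; contradiction)
open import Relation.Nullary.Decidable
  using (¬?; _×-dec_; _→-dec_; _⊎-dec_; decidable-stable; dec-true; map′)
open import Relation.Unary using (Pred; Decidable)

-- Extrema of decidable predicates

least : ∀ {P : Pred ℕ 0ℓ} → Decidable P → ∀ {k} → P k → ∃ (IsLeast P)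
least P? {zero}  p = 0 , p , λ _ _ → z≤n
least P? {suc k} p with P? 0
... | yes p₀ = 0 , p₀ , λ _ _ → z≤n
... | no ¬p₀ with least (P? ∘ suc) p
...   | j , pⱼ , min = suc j , pⱼ , λ where
        zero    p₀ → contradiction p₀ ¬p₀
        (suc i) pᵢ → s≤s (min i pᵢ)

greatest : ∀ {P : Pred ℕ 0ℓ} → Decidable P → ∀ {k} → P k →
           ∀ n → (∀ j → P j → j ≤ n) → ∃ (IsGreatest P)
-- A bound of 0 forces the given witness down to 0.
greatest {P} P? pₖ zero    bd = 0 , subst P (ℕ.n≤0⇒n≡0 (bd _ pₖ)) pₖ , bd
greatest     P? pₖ (suc n) bd with P? (suc n)
... | yes p = suc n , p , bd
... | no ¬p = greatest P? pₖ n λ j pⱼ → case ℕ.m≤n⇒m<n∨m≡n (bd j pⱼ) of λ where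
        (inj₁ (s≤s j≤n)) → j≤n
        (inj₂ refl)      → contradiction pⱼ ¬p

-- Subsets of Fin n

allSubset? : ∀ {n} {P : Pred (Subset n) 0ℓ} → Decidable P → Dec (∀ p → P p)
allSubset? P? = map′ (λ ¬∃ p → decidable-stable (P? p) (λ ¬p → ¬∃ (p , ¬p)))
                     (λ ∀P (p , ¬p) → ¬p (∀P p))
                     (¬? (anySubset? (¬? ∘ P?)))

∣⁅x⁆∪p∣≡1+∣p∣ : ∀ {n x} {p : Subset n} → x ∉ p → ∣ ⁅ x ⁆ ∪ˢ p ∣ ≡ suc ∣ p ∣
∣⁅x⁆∪p∣≡1+∣p∣ {x = zero}  {inside  ∷ p} x∉p = contradiction here x∉p
∣⁅x⁆∪p∣≡1+∣p∣ {x = zero}  {outside ∷ p} x∉p = cong (suc ∘ ∣_∣) (∪-identityˡ p)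
∣⁅x⁆∪p∣≡1+∣p∣ {x = suc x} {inside  ∷ p} x∉p = cong suc (∣⁅x⁆∪p∣≡1+∣p∣ (x∉p ∘ there))
∣⁅x⁆∪p∣≡1+∣p∣ {x = suc x} {outside ∷ p} x∉p = ∣⁅x⁆∪p∣≡1+∣p∣ (x∉p ∘ there)

∣p∪q∣≤∣p∣+∣q∣ : ∀ {n} (p q : Subset n) → ∣ p ∪ˢ q ∣ ≤ ∣ p ∣ + ∣ q ∣
∣p∪q∣≤∣p∣+∣q∣ []            []            = z≤n
∣p∪q∣≤∣p∣+∣q∣ (outside ∷ p) (outside ∷ q) = ∣p∪q∣≤∣p∣+∣q∣ p q
∣p∪q∣≤∣p∣+∣q∣ (outside ∷ p) (inside  ∷ q) =
  ℕ.≤-trans (s≤s (∣p∪q∣≤∣p∣+∣q∣ p q)) (ℕ.≤-reflexive (sym (ℕ.+-suc ∣ p ∣ ∣ q ∣)))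
∣p∪q∣≤∣p∣+∣q∣ (inside  ∷ p) (outside ∷ q) = s≤s (∣p∪q∣≤∣p∣+∣q∣ p q)
∣p∪q∣≤∣p∣+∣q∣ (inside  ∷ p) (inside  ∷ q) =
  s≤s (ℕ.≤-trans (∣p∪q∣≤∣p∣+∣q∣ p q) (ℕ.+-monoʳ-≤ ∣ p ∣ (ℕ.n≤1+n _)))

⊆∧∣q∣≤∣p∣⇒≡ : ∀ {n} {p q : Subset n} → p ⊆ q → ∣ q ∣ ≤ ∣ p ∣ → p ≡ q
⊆∧∣q∣≤∣p∣⇒≡ {p = p} p⊆q q≤p = ⊆-antisym p⊆q λ {x} x∈q →
  decidable-stable (x ∈? p) λ x∉p → ℕ.<⇒≱ (p⊂q⇒∣p∣<∣q∣ (p⊆q , x , x∈q , x∉p)) q≤p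

module _ {n} {P : Pred (Fin n) 0ℓ} (P? : Decidable P) where

  comprehension : Subset n
  comprehension = tabulate (does ∘ P?)

  ∈-comprehension⁺ : ∀ {x} → P x → x ∈ comprehension
  ∈-comprehension⁺ {x} px = lookup⇒[]= x _ (trans (lookup∘tabulate _ x) (dec-true (P? x) px))

  ∈-comprehension⁻ : ∀ {x} → x ∈ comprehension → P x
  ∈-comprehension⁻ {x} x∈ with P? x | trans (sym (lookup∘tabulate (does ∘ P?) x)) ([]=⇒lookup x∈)
  ... | yes px | _ = px

setOf : ∀ {n} → List (Fin n) → Subset n
setOf = foldr (λ x p → ⁅ x ⁆ ∪ˢ p) ⊥

∈-setOf⁺ : ∀ {n x} {xs : List (Fin n)} → x ∈ˡ xs → x ∈ setOf xs
∈-setOf⁺ (here refl) = x∈p∪q⁺ (inj₁ (x∈⁅x⁆ _))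
∈-setOf⁺ (there x∈)  = x∈p∪q⁺ (inj₂ (∈-setOf⁺ x∈))

∈-setOf⁻ : ∀ {n x} (xs : List (Fin n)) → x ∈ setOf xs → x ∈ˡ xs
∈-setOf⁻ []       x∈ = contradiction x∈ ∉⊥
∈-setOf⁻ (y ∷ xs) x∈ = [ here ∘ x∈⁅y⁆⇒x≡y y , there ∘ ∈-setOf⁻ xs ]′ (x∈p∪q⁻ ⁅ y ⁆ _ x∈)

∉-setOf : ∀ {n x} {xs : List (Fin n)} → All (x ≢_) xs → x ∉ setOf xs
∉-setOf {xs = xs} x≢ x∈ = All.All¬⇒¬Any x≢ (∈-setOf⁻ xs x∈)

∣setOf∣ : ∀ {n} {xs : List (Fin n)} → Unique xs → ∣ setOf xs ∣ ≡ length xs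
∣setOf∣ {n} []      = ∣⊥∣≡0 n
∣setOf∣     (x ∷ u) = trans (∣⁅x⁆∪p∣≡1+∣p∣ (∉-setOf x)) (cong suc (∣setOf∣ u))

setOf-↭ : ∀ {n} {xs ys : List (Fin n)} → xs ↭ ys → setOf xs ≡ setOf ys
setOf-↭ {xs = xs} {ys} π = ⊆-antisym (∈-setOf⁺ ∘ ∈-resp-↭ π ∘ ∈-setOf⁻ xs)
                                     (∈-setOf⁺ ∘ ∈-resp-↭ (↭-sym π) ∘ ∈-setOf⁻ ys)

setOf-map-suc : ∀ {n} (xs : List (Fin n)) → setOf (map suc xs) ≡ outside ∷ setOf xs
setOf-map-suc []       = refl
setOf-map-suc (x ∷ xs) = cong (⁅ suc x ⁆ ∪ˢ_) (setOf-map-suc xs)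

enumerate : ∀ {n} (p : Subset n) → ∃[ xs ] Unique xs × setOf xs ≡ p
enumerate []            = [] , [] , refl
enumerate (outside ∷ p) with enumerate p
... | xs , u , refl = map suc xs , Unique.map⁺ suc-injective u , setOf-map-suc xs
enumerate (inside ∷ p) with enumerate p
... | xs , u , refl = zero ∷ map suc xs
                    , All.map⁺ (All.universal (λ _ → 0≢1+n) xs) ∷ Unique.map⁺ suc-injective u
                    , trans (cong (⁅ zero ⁆ ∪ˢ_) (setOf-map-suc xs)) (cong (inside ∷_) (∪-identityˡ _))

-- With a numeral for `k`, matching on the length exposes the elements by name, which turns a claim
-- about 3-sets or 4-sets into one about distinct vertices.
enumerate-length : ∀ {n k} (p : Subset n) → ∣ p ∣ ≡ k →
                   ∃[ xs ] length xs ≡ k × Unique xs × setOf xs ≡ p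
enumerate-length p refl with enumerate p
... | xs , u , refl = xs , sym (∣setOf∣ u) , u , refl

-- Union bound. Enumerating `A` makes the union of the sets `S i` a finite fold, whose size is
-- bounded term by term.
∣p∣≤-cover : ∀ {n m} {A : Subset n} {U : Subset m} {b} (S : Fin n → Subset m) →
             (∀ {i} → i ∈ A → ∣ S i ∣ ≤ b) →
             (∀ {u} → u ∈ U → ∃[ i ] i ∈ A × u ∈ S i) →
             ∣ U ∣ ≤ ∣ A ∣ * b
∣p∣≤-cover {m = m} {A} {U} {b} S bd cov with enumerate A
... | xs , u , refl = ℕ.≤-trans (p⊆q⇒∣p∣≤∣q∣ U⊆⋃)
                        (subst (λ l → ∣ ⋃S xs ∣ ≤ l * b) (sym (∣setOf∣ u)) (∣⋃∣≤ xs (bd ∘ ∈-setOf⁺)))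
  where
  ⋃S = foldr (λ i p → S i ∪ˢ p) ⊥

  ∈⋃S : ∀ {i u ys} → i ∈ˡ ys → u ∈ S i → u ∈ ⋃S ys
  ∈⋃S (here refl) u∈ = x∈p∪q⁺ (inj₁ u∈)
  ∈⋃S (there i∈)  u∈ = x∈p∪q⁺ (inj₂ (∈⋃S i∈ u∈))

  U⊆⋃ : U ⊆ ⋃S xs
  U⊆⋃ u∈U with cov u∈U
  ... | i , i∈A , u∈Sᵢ = ∈⋃S (∈-setOf⁻ xs i∈A) u∈Sᵢ

  ∣⋃∣≤ : ∀ ys → (∀ {i} → i ∈ˡ ys → ∣ S i ∣ ≤ b) → ∣ ⋃S ys ∣ ≤ length ys * b
  ∣⋃∣≤ []       _  = ℕ.≤-reflexive (∣⊥∣≡0 m)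
  ∣⋃∣≤ (y ∷ ys) bd = ℕ.≤-trans (∣p∪q∣≤∣p∣+∣q∣ (S y) (⋃S ys))
                       (ℕ.+-mono-≤ (bd (here refl)) (∣⋃∣≤ ys (bd ∘ there)))

-- 2K₂-free graphs

module _ {m} (_~_ : Rel (Fin m) 0ℓ) where

  IsClique IsIndependent : Pred (Subset m) 0ℓ
  IsClique      S = ∀ x y → x ∈ S → y ∈ S → x ≢ y → x ~ y
  IsIndependent S = ∀ x y → x ∈ S → y ∈ S → ¬ (x ~ y)

module _ {m} {_~_ : Rel (Fin m) 0ℓ} (_~?_ : Decidable₂ _~_)
         (~-sym : Symmetric _~_) (~-irrefl : ∀ {x} → ¬ (x ~ x))
         (2K₂-free : ∀ {x y z w} → x ~ y → z ~ w →
                     ¬ (x ~ z) → ¬ (x ~ w) → ¬ (y ~ z) → ¬ (y ~ w) → Absurd)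
  where

  private

    isClique? : Decidable (IsClique _~_)
    isClique? S = all? λ x → all? λ y →
      (x ∈? S) →-dec (y ∈? S) →-dec (¬? (x ≟ᶠ y)) →-dec (x ~? y)

    extend : ∀ {S u} → IsClique _~_ S → (∀ {w} → w ∈ S → u ~ w) → IsClique _~_ (⁅ u ⁆ ∪ˢ S)
    extend {S} {u} cl adj x y x∈ y∈ x≢y
      with x∈p∪q⁻ ⁅ u ⁆ S x∈ | x∈p∪q⁻ ⁅ u ⁆ S y∈
    ... | inj₂ x∈S | inj₂ y∈S = cl x y x∈S y∈S x≢y
    ... | inj₁ x∈u | inj₂ y∈S with refl ← x∈⁅y⁆⇒x≡y u x∈u = adj y∈S
    ... | inj₂ x∈S | inj₁ y∈u with refl ← x∈⁅y⁆⇒x≡y u y∈u = ~-sym (adj x∈S)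
    ... | inj₁ x∈u | inj₁ y∈u =
      contradiction (trans (x∈⁅y⁆⇒x≡y u x∈u) (sym (x∈⁅y⁆⇒x≡y u y∈u))) x≢y

    module MaximumClique {A} (clq : IsClique _~_ A) (max : ∀ S → IsClique _~_ S → ∣ S ∣ ≤ ∣ A ∣) where

      -- The third component matters on the diagonal only: there i must be the
      -- sole non-neighbour of u in A.
      Cell : Fin m → Fin m → Pred (Fin m) 0ℓ
      Cell i j u = ¬ (u ~ i) × ¬ (u ~ j) × (i ≡ j → ∀ w → w ∈ A → w ≢ i → u ~ w)

      cell? : ∀ i j → Decidable (Cell i j)
      cell? i j u = ¬? (u ~? i) ×-dec ¬? (u ~? j) ×-dec
        ((i ≟ᶠ j) →-dec all? λ w → (w ∈? A) →-dec (¬? (w ≟ᶠ i)) →-dec (u ~? w))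

      cell : Fin m → Fin m → Subset m
      cell i j = comprehension (cell? i j)

      -- Two adjacent vertices of the diagonal cell at i could replace i in A.
      cell-independent : ∀ {i j} → i ∈ A → j ∈ A → IsIndependent _~_ (cell i j)
      cell-independent {i} {j} i∈A j∈A u v u∈ v∈ u~v
        with ∈-comprehension⁻ (cell? i j) u∈ | ∈-comprehension⁻ (cell? i j) v∈ | i ≟ᶠ j
      -- Off the diagonal, `u ~ v` and the edge `i ~ j` of the clique would form an induced 2K₂.
      ... | u≁i , u≁j , _ | v≁i , v≁j , _ | no i≢j =
        2K₂-free u~v (clq i j i∈A j∈A i≢j) u≁i u≁j v≁i v≁j
      ... | u≁i , _ , uA | v≁i , _ , vA | yes refl = ℕ.<⇒≱ ∣A∣<∣A′∣ (max A′ A′-clique)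
        where
        B = A ∩ ∁ ⁅ i ⁆
        A′ = ⁅ u ⁆ ∪ˢ (⁅ v ⁆ ∪ˢ B)

        -- If `x` is `i`, then `x ~ y` contradicts `y≁i`; every other member of the clique is
        -- adjacent to `i`.
        outsideA : ∀ {x y} → x ~ y → ¬ (x ~ i) → ¬ (y ~ i) → x ∉ A
        outsideA {x} x~y x≁i y≁i x∈A with x ≟ᶠ i
        ... | yes refl = y≁i (~-sym x~y)
        ... | no x≢i   = x≁i (clq x i x∈A i∈A x≢i)

        adjB : ∀ {x} → (∀ w → w ∈ A → w ≢ i → x ~ w) → ∀ {w} → w ∈ B → x ~ w
        adjB xA w∈B with x∈p∩q⁻ A (∁ ⁅ i ⁆) w∈B
        ... | w∈A , w∈∁i = xA _ w∈A λ { refl → x∈∁p⇒x∉p w∈∁i (x∈⁅x⁆ i) }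

        B-clique : IsClique _~_ B
        B-clique x y x∈ y∈ = clq x y (p∩q⊆p A _ x∈) (p∩q⊆p A _ y∈)

        u~ : ∀ {w} → w ∈ ⁅ v ⁆ ∪ˢ B → u ~ w
        u~ w∈ with x∈p∪q⁻ ⁅ v ⁆ B w∈
        ... | inj₁ w∈v with refl ← x∈⁅y⁆⇒x≡y v w∈v = u~v
        ... | inj₂ w∈B = adjB (uA refl) w∈B

        A′-clique : IsClique _~_ A′
        A′-clique = extend (extend B-clique (adjB (vA refl))) u~

        A⊆i∪B : A ⊆ ⁅ i ⁆ ∪ˢ B
        A⊆i∪B {x} x∈A with x ∈? ⁅ i ⁆
        ... | yes x∈i = x∈p∪q⁺ (inj₁ x∈i)
        ... | no x∉i  = x∈p∪q⁺ (inj₂ (x∈p∩q⁺ (x∈A , x∉p⇒x∈∁p x∉i)))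

        ∣A∣<∣A′∣ : ∣ A ∣ < ∣ A′ ∣
        ∣A∣<∣A′∣ = begin-strict
          ∣ A ∣               ≤⟨ p⊆q⇒∣p∣≤∣q∣ A⊆i∪B ⟩
          ∣ ⁅ i ⁆ ∪ˢ B ∣      ≤⟨ ∣p∪q∣≤∣p∣+∣q∣ ⁅ i ⁆ B ⟩
          ∣ ⁅ i ⁆ ∣ + ∣ B ∣   ≡⟨ cong (_+ ∣ B ∣) (∣⁅x⁆∣≡1 i) ⟩
          suc ∣ B ∣           ≡⟨ ∣⁅x⁆∪p∣≡1+∣p∣ (outsideA (~-sym u~v) v≁i u≁i ∘ p∩q⊆p A _) ⟨
          ∣ ⁅ v ⁆ ∪ˢ B ∣      <⟨ ℕ.n<1+n _ ⟩
          -- `u` is adjacent to all of this set and hence, by irreflexivity, not in it.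
          suc ∣ ⁅ v ⁆ ∪ˢ B ∣  ≡⟨ ∣⁅x⁆∪p∣≡1+∣p∣ (~-irrefl ∘ u~) ⟨
          ∣ A′ ∣              ∎
          where open ℕ.≤-Reasoning

      -- A vertex adjacent to all of `A` would lie outside `A` and enlarge it, so `u` has a
      -- non-neighbour `i` in `A`. A second one, `j`, puts `u` off the diagonal; otherwise `i` is
      -- the only one and `u` is in the diagonal cell at `i`.
      cells-cover : ∀ u → ∃[ i ] i ∈ A × ∃[ j ] j ∈ A × Cell i j u
      cells-cover u with any? (λ i → (i ∈? A) ×-dec ¬? (u ~? i))
      ... | no ¬∃i = contradiction (max _ (extend clq u~A))
                       (ℕ.<⇒≱ (ℕ.≤-reflexive (sym (∣⁅x⁆∪p∣≡1+∣p∣ (~-irrefl ∘ u~A)))))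
        where
        u~A : ∀ {w} → w ∈ A → u ~ w
        u~A {w} w∈A = decidable-stable (u ~? w) λ u≁w → ¬∃i (w , w∈A , u≁w)
      ... | yes (i , i∈A , u≁i) with any? (λ j → (j ∈? A) ×-dec ¬? (j ≟ᶠ i) ×-dec ¬? (u ~? j))
      ...   | yes (j , j∈A , j≢i , u≁j) =
        i , i∈A , j , j∈A , u≁i , u≁j , λ i≡j → contradiction (sym i≡j) j≢i
      ...   | no ¬∃j = i , i∈A , i , i∈A , u≁i , u≁i , λ _ w w∈A w≢i →
        decidable-stable (u ~? w) λ u≁w → ¬∃j (w , w∈A , w≢i , u≁w)

      -- Two nested union bounds: the rows cover all vertices, and the cells `cell i j` with `j` in
      -- `A` cover row `i`. Each cell is independent, hence of size at most `k`.
      m≤∣A∣²k : ∀ {k} → (∀ S → IsIndependent _~_ S → ∣ S ∣ ≤ k) → m ≤ ∣ A ∣ * (∣ A ∣ * k)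
      m≤∣A∣²k {k} ind = subst (_≤ ∣ A ∣ * (∣ A ∣ * k)) (∣⊤∣≡n m) (∣p∣≤-cover {U = ⊤} row ∣row∣≤ rows-cover)
        where
        row? = λ i u → any? λ j → (j ∈? A) ×-dec cell? i j u
        row = λ i → comprehension (row? i)

        rows-cover : ∀ {u} → u ∈ ⊤ → ∃[ i ] i ∈ A × u ∈ row i
        rows-cover {u} _ with cells-cover u
        ... | i , i∈A , ∃j = i , i∈A , ∈-comprehension⁺ (row? i) ∃j

        ∣row∣≤ : ∀ {i} → i ∈ A → ∣ row i ∣ ≤ ∣ A ∣ * k
        ∣row∣≤ {i} i∈A = ∣p∣≤-cover (cell i) (λ j∈A → ind _ (cell-independent i∈A j∈A)) λ u∈ →
          case ∈-comprehension⁻ (row? i) u∈ of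
          λ (j , j∈A , c) → j , j∈A , ∈-comprehension⁺ (cell? i j) c

  2K₂-free⇒order≤ : ∀ {k} → (∀ S → IsClique _~_ S → ∣ S ∣ ≤ k) → (∀ S → IsIndependent _~_ S → ∣ S ∣ ≤ k) →
                    m ≤ k * (k * k)
  2K₂-free⇒order≤ {k} cl ind
    with greatest (λ s → anySubset? λ S → isClique? S ×-dec (∣ S ∣ ℕ.≟ s))
                  -- The search for a maximum clique starts from the empty one and is bounded by
                  -- `k`.
                  (⊥ , (λ _ _ x∈ _ _ → contradiction x∈ ∉⊥) , refl)
                  k (λ { _ (S , clq , refl) → cl S clq })
  ... | _ , (A , clq , refl) , max =
    ℕ.≤-trans (MaximumClique.m≤∣A∣²k clq (λ S c → max _ (S , c , refl)) ind)
              (ℕ.*-mono-≤ (cl A clq) (ℕ.*-monoˡ-≤ k (cl A clq)))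

-- Hypergraphs with the same edge set

_≟ˢ_ : ∀ {n} → DecidableEquality (Subset n)
_≟ˢ_ = Vec-≡-dec Bool._≟_

-- Without repetitions all multiplicities are 0 or 1, so the same members means the same bag, and
-- equal bags are permutations of each other.
unique∧set⇒↭ : ∀ {A : Set} {xs ys : List A} → Unique xs → Unique ys →
               (∀ {x} → x ∈ˡ xs → x ∈ˡ ys) → (∀ {x} → x ∈ˡ ys → x ∈ˡ xs) → xs ↭ ys
unique∧set⇒↭ u v f g = ∼bag⇒↭ (unique∧set⇒bag u v (mk⇔ f g))

module _ {r n} (H : Hypergraph r n) where

  edge? : Decidable (_∈ˡ edges H)
  edge? e = ∈ˡ? _≟ˢ_ e (edges H)

  homogeneous? : Decidable (Homogeneous H)
  homogeneous? S =
    allSubset? (λ e → (∣ e ∣ ℕ.≟ r) →-dec (e ⊆? S) →-dec edge? e) ⊎-dec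
    allSubset? (λ e → (∣ e ∣ ℕ.≟ r) →-dec (e ⊆? S) →-dec ¬? (edge? e))

  containsInduced? : Decidable (ContainsInduced H)
  containsInduced? (m , f) =
    anySubset? λ W → (∣ W ∣ ℕ.≟ m) ×-dec (length (inducedEdges H W) ℕ.≟ f)

module _ {r n} {G H : Hypergraph r n} (π : edges G ↭ edges H) where

  Free-resp-↭ : ∀ {Q} → Free G Q → Free H Q
  Free-resp-↭ free q q∈Q (W , ∣W∣≡m , len) =
    free q q∈Q (W , ∣W∣≡m , trans (↭-length (filter-↭ (_⊆? W) π)) len)

  Homogeneous-resp-↭ : ∀ {S} → Homogeneous G S → Homogeneous H S
  Homogeneous-resp-↭ (inj₁ cl) = inj₁ λ e ∣e∣ e⊆S → ∈-resp-↭ π (cl e ∣e∣ e⊆S)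
  Homogeneous-resp-↭ (inj₂ co) = inj₂ λ e ∣e∣ e⊆S → co e ∣e∣ e⊆S ∘ ∈-resp-↭ (↭-sym π)

Is-h-resp-↭ : ∀ {r n k} {G H : Hypergraph r n} → edges G ↭ edges H → Is-h G k → Is-h H k
Is-h-resp-↭ {G = G} {H} π ((S , hom , ∣S∣) , max) =
  (S , Homogeneous-resp-↭ {G = G} {H} π hom , ∣S∣) ,
  λ { j (T , hom′ , ∣T∣) → max j (T , Homogeneous-resp-↭ {G = H} {G} (↭-sym π) hom′ , ∣T∣) }

IsGreatest-unique : ∀ {P : Pred ℕ 0ℓ} {j k} → IsGreatest P j → IsGreatest P k → j ≡ k
IsGreatest-unique (pⱼ , maxⱼ) (pₖ , maxₖ) = ℕ.≤-antisym (maxₖ _ pⱼ) (maxⱼ _ pₖ)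

h-exists : ∀ {n} (H : Hypergraph 3 n) → ∃ (Is-h H)
h-exists {n} H =
  greatest (λ s → anySubset? λ S → homogeneous? H S ×-dec (∣ S ∣ ℕ.≟ s))
           (⊥ , inj₁ ⊥-clique , ∣⊥∣≡0 n)
           n (λ { _ (S , _ , refl) → ∣p∣≤n S })
  where
  -- Vacuous: no 3-set fits into the empty set. This gives the search for the largest homogeneous
  -- set a candidate to start from.
  ⊥-clique : Clique H ⊥
  ⊥-clique e ∣e∣ e⊆⊥ with () ← ℕ.≤-trans (ℕ.≤-reflexive (sym ∣e∣))
                               (ℕ.≤-trans (p⊆q⇒∣p∣≤∣q∣ e⊆⊥) (ℕ.≤-reflexive (∣⊥∣≡0 n)))

-- Enumeration of the hypergraphs on a finite vertex set

allSubsets : ∀ n → List (Subset n)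
allSubsets zero    = [ [] ]
allSubsets (suc n) = map (inside ∷_) (allSubsets n) ++ map (outside ∷_) (allSubsets n)

∈-allSubsets : ∀ {n} (p : Subset n) → p ∈ˡ allSubsets n
∈-allSubsets []            = here refl
∈-allSubsets (inside  ∷ p) = ∈-++⁺ˡ (∈-map⁺ _ (∈-allSubsets p))
∈-allSubsets (outside ∷ p) = ∈-++⁺ʳ _ (∈-map⁺ _ (∈-allSubsets p))

allSubsets-unique : ∀ n → Unique (allSubsets n)
allSubsets-unique zero    = [] ∷ []
allSubsets-unique (suc n) = Unique.++⁺ (Unique.map⁺ Vec-∷-injectiveʳ (allSubsets-unique n))
                                       (Unique.map⁺ Vec-∷-injectiveʳ (allSubsets-unique n))
  λ (p∈ , q∈) → case ∈-map⁻ _ p∈ , ∈-map⁻ _ q∈ of λ { ((_ , _ , refl) , (_ , _ , ())) }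

sublists : ∀ {A : Set} → List A → List (List A)
sublists []       = [ [] ]
sublists (x ∷ xs) = map (x ∷_) (sublists xs) ++ sublists xs

filter∈sublists : ∀ {A : Set} {P : Pred A 0ℓ} (P? : Decidable P) xs → filter P? xs ∈ˡ sublists xs
filter∈sublists P? []       = here refl
filter∈sublists P? (x ∷ xs) with P? x
... | yes _ = ∈-++⁺ˡ (∈-map⁺ _ (filter∈sublists P? xs))
... | no  _ = ∈-++⁺ʳ _ (filter∈sublists P? xs)

-- Up to the order of its edges, every hypergraph is a sublist of allSubsets n.
anyHypergraph? : ∀ {r n} {P : Pred (Hypergraph r n) 0ℓ} → Decidable P →
                 (∀ {G H} → edges G ↭ edges H → P G → P H) → Dec (∃ P)
anyHypergraph? {r} {n} {P} P? resp =
  map′ (λ any → case Any.satisfied any of λ (es , u , v , p) → _ , p) complete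
       (Any.any? realised? (sublists (allSubsets n)))
  where
  Realised : Pred (List (Subset n)) 0ℓ
  Realised es = ∃[ u ] ∃[ v ] P (record { edges = es ; unique = u ; uniform = v })

  realised? : Decidable Realised
  realised? es with unique? _≟ˢ_ es | All.all? (λ e → ∣ e ∣ ℕ.≟ r) es
  ... | no ¬u | _     = no λ (u , _) → ¬u u
  ... | _     | no ¬v = no λ (_ , v , _) → ¬v v
  -- A realisation may carry other proofs of uniqueness and uniformity than `u` and `v`. The edge
  -- lists are the same, so `resp refl` transfers `P` between them.
  ... | yes u | yes v = map′ (λ p → u , v , p) (λ (_ , _ , p) → resp refl p) (P? _)

  complete : ∃ P → Any Realised (sublists (allSubsets n))
  complete (H , p) = lose (filter∈sublists (edge? H) (allSubsets n)) (u , v , resp (↭-sym π) p)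
    where
    u = Unique.filter⁺ (edge? H) (allSubsets-unique n)
    v = All.map (All.lookup (uniform H)) (All.all-filter (edge? H) (allSubsets n))
    π = unique∧set⇒↭ u (unique H) (proj₂ ∘ ∈-filter⁻ (edge? H) {xs = allSubsets n})
                                  (∈-filter⁺ (edge? H) (∈-allSubsets _))

-- Four vertices

-- Going through a list makes any reordering of the vertices an equality of sets, by `setOf-↭`.
tri : ∀ {n} → Fin n → Fin n → Fin n → Subset n
tri a b c = setOf (a ∷ b ∷ c ∷ [])

∈-tri₁ : ∀ {n} {a : Fin n} b c → a ∈ tri a b c
∈-tri₁ {a = a} b c = ∈-setOf⁺ {xs = a ∷ b ∷ c ∷ []} (here refl)

∈-tri₂ : ∀ {n} (a : Fin n) {b} c → b ∈ tri a b c
∈-tri₂ a {b} c = ∈-setOf⁺ {xs = a ∷ b ∷ c ∷ []} (there (here refl))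

∈-tri₃ : ∀ {n} (a b : Fin n) {c} → c ∈ tri a b c
∈-tri₃ a b {c} = ∈-setOf⁺ {xs = a ∷ b ∷ c ∷ []} (there (there (here refl)))

tri-rotate : ∀ {n} (a b c : Fin n) → tri a b c ≡ tri b c a
tri-rotate a b c = setOf-↭ {xs = a ∷ b ∷ c ∷ []} (↭-trans (swap a b refl) (prep b (swap a c refl)))

tri-swap : ∀ {n} (a b c : Fin n) → tri a b c ≡ tri a c b
tri-swap a b c = setOf-↭ {xs = a ∷ b ∷ c ∷ []} (prep a (swap b c refl))

-- The permutation `xs ↭ y ∷ ys` encodes the removal of the vertex `y`, so that one argument serves
-- all four positions of `y`.
setOf-face⊆ : ∀ {n y} {xs ys : List (Fin n)} → xs ↭ y ∷ ys → setOf ys ⊆ setOf xs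
setOf-face⊆ {ys = ys} π x∈ = ∈-setOf⁺ (∈-resp-↭ (↭-sym π) (there (∈-setOf⁻ ys x∈)))

≡setOf-face : ∀ {n y} {xs ys : List (Fin n)} {e} → xs ↭ y ∷ ys → ∣ setOf ys ∣ ≤ ∣ e ∣ →
              e ⊆ setOf xs → y ∉ e → e ≡ setOf ys
≡setOf-face {y = y} {xs} {ys} {e} π ∣ys∣≤∣e∣ e⊆ y∉e = ⊆∧∣q∣≤∣p∣⇒≡ e⊆ys ∣ys∣≤∣e∣
  where
  e⊆ys : e ⊆ setOf ys
  e⊆ys x∈e with ∈-resp-↭ π (∈-setOf⁻ xs (e⊆ x∈e))
  ... | here refl = contradiction x∈e y∉e
  ... | there x∈  = ∈-setOf⁺ x∈

∣setOf∣≤ : ∀ {n} (xs : List (Fin n)) → ∣ setOf xs ∣ ≤ length xs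
∣setOf∣≤ {n} []   = ℕ.≤-reflexive (∣⊥∣≡0 n)
∣setOf∣≤ (x ∷ xs) = ℕ.≤-trans (∣p∪q∣≤∣p∣+∣q∣ ⁅ x ⁆ (setOf xs))
  (ℕ.+-mono-≤ (ℕ.≤-reflexive (∣⁅x⁆∣≡1 x)) (∣setOf∣≤ xs))

faces : ∀ {n} → Fin n → Fin n → Fin n → Fin n → List (Subset n)
faces a b c d = tri a b c ∷ tri a b d ∷ tri a c d ∷ tri b c d ∷ []

-- Each face omits a vertex that all later faces in the list contain: `d`, then `c`, then `b`.
faces-unique : ∀ {n} {a b c d : Fin n} → Unique (a ∷ b ∷ c ∷ d ∷ []) → Unique (faces a b c d)
faces-unique {a = a} {b} {c} {d} ((a≢b ∷ a≢c ∷ a≢d ∷ []) ∷ (b≢c ∷ b≢d ∷ []) ∷ (c≢d ∷ []) ∷ [] ∷ []) =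
  (d≠ (∈-tri₃ a b) ∷ d≠ (∈-tri₃ a c) ∷ d≠ (∈-tri₃ b c) ∷ []) ∷
  (c≠ (∈-tri₂ a d) ∷ c≠ (∈-tri₂ b d) ∷ []) ∷
  (b≠ (∈-tri₁ c d) ∷ []) ∷ [] ∷ []
  where
  separate : ∀ {x} {p q : Subset _} → x ∉ p → x ∈ q → p ≢ q
  separate x∉p x∈q refl = x∉p x∈q
  d≠ : ∀ {q} → d ∈ q → tri a b c ≢ q
  d≠ = separate (∉-setOf (≢-sym a≢d ∷ ≢-sym b≢d ∷ ≢-sym c≢d ∷ []))
  c≠ : ∀ {q} → c ∈ q → tri a b d ≢ q
  c≠ = separate (∉-setOf (≢-sym a≢c ∷ ≢-sym b≢c ∷ c≢d ∷ []))
  b≠ : ∀ {q} → b ∈ q → tri a c d ≢ q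
  b≠ = separate (∉-setOf (≢-sym a≢b ∷ b≢c ∷ b≢d ∷ []))

module _ {n} (H : Hypergraph 3 n) where

  clique-fromTriples : ∀ {S} → (∀ {a b c} → a ∈ S → b ∈ S → c ∈ S → Unique (a ∷ b ∷ c ∷ []) →
                       tri a b c ∈ˡ edges H) → Clique H S
  clique-fromTriples tr e ∣e∣ e⊆S with enumerate-length e ∣e∣
  ... | a ∷ b ∷ c ∷ [] , refl , u , refl =
    tr (e⊆S (∈-tri₁ b c)) (e⊆S (∈-tri₂ a c)) (e⊆S (∈-tri₃ a b)) u

  module _ {a b c d : Fin n} (u : Unique (a ∷ b ∷ c ∷ d ∷ [])) where

    private
      W = setOf (a ∷ b ∷ c ∷ d ∷ [])

      remove-a : a ∷ b ∷ c ∷ d ∷ [] ↭ a ∷ b ∷ c ∷ d ∷ []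
      remove-a = refl
      remove-b : a ∷ b ∷ c ∷ d ∷ [] ↭ b ∷ a ∷ c ∷ d ∷ []
      remove-b = swap a b refl
      remove-c : a ∷ b ∷ c ∷ d ∷ [] ↭ c ∷ a ∷ b ∷ d ∷ []
      remove-c = ↭-trans (prep a (swap b c refl)) (swap a c refl)
      remove-d : a ∷ b ∷ c ∷ d ∷ [] ↭ d ∷ a ∷ b ∷ c ∷ []
      remove-d = ↭-trans (prep a (↭-trans (prep b (swap c d refl)) (swap b d refl))) (swap a d refl)

      faces⊆W : ∀ {e} → e ∈ˡ faces a b c d → e ⊆ W
      faces⊆W (here refl)                         = setOf-face⊆ remove-d
      faces⊆W (there (here refl))                 = setOf-face⊆ remove-c
      faces⊆W (there (there (here refl)))         = setOf-face⊆ remove-b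
      faces⊆W (there (there (there (here refl)))) = setOf-face⊆ remove-a

      avoiding : ∀ {e y xs} → ∣ e ∣ ≡ 3 → e ⊆ W → a ∷ b ∷ c ∷ d ∷ [] ↭ y ∷ xs → y ∉ e → e ≡ setOf xs
      avoiding {xs = xs} ∣e∣ e⊆W π = ≡setOf-face π ∣xs∣≤∣e∣ e⊆W
        where
        ∣xs∣≤∣e∣ = ℕ.≤-trans (∣setOf∣≤ xs)
          (ℕ.≤-reflexive (trans (ℕ.suc-injective (sym (↭-length π))) (sym ∣e∣)))

      -- Three elements cannot include all four vertices, and a 3-set that misses one of them is the
      -- opposite face.
      3-subset∈faces : ∀ {e} → ∣ e ∣ ≡ 3 → e ⊆ W → e ∈ˡ faces a b c d
      3-subset∈faces {e} ∣e∣ e⊆W with a ∈? e | b ∈? e | c ∈? e | d ∈? e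
      ... | _       | _       | _       | no d∉e  = here (avoiding ∣e∣ e⊆W remove-d d∉e)
      ... | _       | _       | no c∉e  | yes _   = there (here (avoiding ∣e∣ e⊆W remove-c c∉e))
      ... | _       | no b∉e  | yes _   | yes _   = there (there (here (avoiding ∣e∣ e⊆W remove-b b∉e)))
      ... | no a∉e  | yes _   | yes _   | yes _   = there (there (there (here (avoiding ∣e∣ e⊆W remove-a a∉e))))
      ... | yes a∈e | yes b∈e | yes c∈e | yes d∈e = contradiction ∣W∣≤∣e∣ (ℕ.<⇒≱ ∣e∣<∣W∣)
        where
        ∣W∣≤∣e∣ : ∣ W ∣ ≤ ∣ e ∣
        ∣W∣≤∣e∣ = p⊆q⇒∣p∣≤∣q∣ λ x∈W →
          All.lookup {P = _∈ e} (a∈e ∷ b∈e ∷ c∈e ∷ d∈e ∷ []) (∈-setOf⁻ (a ∷ b ∷ c ∷ d ∷ []) x∈W)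

        ∣e∣<∣W∣ : ∣ e ∣ < ∣ W ∣
        ∣e∣<∣W∣ = ℕ.≤-reflexive (trans (cong suc ∣e∣) (sym (∣setOf∣ u)))

    -- Counting induced edges on four vertices thereby becomes four membership tests on explicit
    -- triples.
    inducedEdges-↭ : inducedEdges H W ↭ filter (edge? H) (faces a b c d)
    inducedEdges-↭ = unique∧set⇒↭ (Unique.filter⁺ (_⊆? W) (unique H)) (Unique.filter⁺ (edge? H) (faces-unique u))
      (λ e∈ → let e∈H , e⊆W = ∈-filter⁻ (_⊆? W) {xs = edges H} e∈ in
              ∈-filter⁺ (edge? H) (3-subset∈faces (All.lookup (uniform H) e∈H) e⊆W) e∈H)
      (λ e∈ → let e∈F , e∈H = ∈-filter⁻ (edge? H) {xs = faces a b c d} e∈ in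
              ∈-filter⁺ (_⊆? W) e∈H (faces⊆W e∈F))

    contains : ∀ {f} → length (filter (edge? H) (faces a b c d)) ≡ f → ContainsInduced H (4 , f)
    contains len = W , ∣setOf∣ u , trans (↭-length inducedEdges-↭) len

-- (4,0)- and (4,3)-free hypergraphs

Q₀₃ : Pred (ℕ × ℕ) 0ℓ
Q₀₃ = ｛ 4 , 0 ｝ ∪ ｛ 4 , 3 ｝

Q₀₃⇒order : ∀ {q} → Q₀₃ q → proj₁ q ≡ 4
Q₀₃⇒order (inj₁ refl) = refl
Q₀₃⇒order (inj₂ refl) = refl

Q₀₃⇒size≢4 : ∀ {q} → Q₀₃ q → proj₂ q ≢ 4
Q₀₃⇒size≢4 (inj₁ refl) ()
Q₀₃⇒size≢4 (inj₂ refl) ()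

free? : ∀ {n} → Decidable (λ (H : Hypergraph 3 n) → Free H Q₀₃)
free? H = map′ (λ { (f₀ , f₃) _ (inj₁ refl) → f₀ ; (f₀ , f₃) _ (inj₂ refl) → f₃ })
               (λ free → free _ (inj₁ refl) , free _ (inj₂ refl))
               (¬? (containsInduced? H (4 , 0)) ×-dec ¬? (containsInduced? H (4 , 3)))

module _ {n} (H : Hypergraph 3 n) (free : Free H Q₀₃) {a b c d : Fin n}
         (u : Unique (a ∷ b ∷ c ∷ d ∷ [])) where

  ¬no-face : tri a b c ∉ˡ edges H → tri a b d ∉ˡ edges H → tri a c d ∉ˡ edges H →
             ¬ (tri b c d ∉ˡ edges H)
  ¬no-face abc abd acd bcd = free _ (inj₁ refl) (contains H u (cong length
    (trans (filter-reject (edge? H) abc) (trans (filter-reject (edge? H) abd)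
    (trans (filter-reject (edge? H) acd) (filter-reject (edge? H) bcd))))))

  -- Otherwise the four vertices span exactly three edges. The face in question heads the list
  -- `faces`, so a single rejection leaves the other three; reordering the vertices gives the
  -- variants for the other faces.
  fourth-face : tri a b d ∈ˡ edges H → tri a c d ∈ˡ edges H → tri b c d ∈ˡ edges H →
                tri a b c ∈ˡ edges H
  fourth-face abd acd bcd = decidable-stable (edge? H (tri a b c)) λ abc →
    free _ (inj₂ refl) (contains H u (cong length
      (trans (filter-reject (edge? H) abc) (filter-all (edge? H) (abd ∷ acd ∷ bcd ∷ [])))))

-- The complete hypergraph and the existence of the minimum

complete : ∀ n → Hypergraph 3 n
complete n = record
  { edges   = filter (λ e → ∣ e ∣ ℕ.≟ 3) (allSubsets n)
  ; unique  = Unique.filter⁺ _ (allSubsets-unique n)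
  ; uniform = All.all-filter _ (allSubsets n)
  }

-- Any four vertices span all four triples here, while the forbidden edge counts are 0 and 3.
complete-free : ∀ n → Free (complete n) Q₀₃
complete-free n q q∈Q (W , ∣W∣ , len) with enumerate-length W (trans ∣W∣ (Q₀₃⇒order q∈Q))
... | a ∷ b ∷ c ∷ d ∷ [] , refl , u , refl = Q₀₃⇒size≢4 q∈Q (trans (sym len) len≡4)
  where
  K = complete n

  tri∈ : ∀ {x y z} → Unique (x ∷ y ∷ z ∷ []) → tri x y z ∈ˡ edges K
  tri∈ v = ∈-filter⁺ (λ e → ∣ e ∣ ℕ.≟ 3) (∈-allSubsets _) (∣setOf∣ v)

  faces∈ : Unique (a ∷ b ∷ c ∷ d ∷ []) → All (_∈ˡ edges K) (faces a b c d)
  faces∈ ((ab ∷ ac ∷ ad ∷ []) ∷ (bc ∷ bd ∷ []) ∷ (cd ∷ []) ∷ [] ∷ []) =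
    tri∈ ((ab ∷ ac ∷ []) ∷ (bc ∷ []) ∷ [] ∷ []) ∷ tri∈ ((ab ∷ ad ∷ []) ∷ (bd ∷ []) ∷ [] ∷ []) ∷
    tri∈ ((ac ∷ ad ∷ []) ∷ (cd ∷ []) ∷ [] ∷ []) ∷ tri∈ ((bc ∷ bd ∷ []) ∷ (cd ∷ []) ∷ [] ∷ []) ∷ []

  len≡4 : length (inducedEdges K W) ≡ 4
  len≡4 = trans (↭-length (inducedEdges-↭ K u)) (cong length (filter-all (edge? K) (faces∈ u)))

h₃-exists : ∀ n → ∃ (Is-hᵣ 3 n Q₀₃)
h₃-exists n = least decide (complete n , complete-free n , proj₂ (h-exists (complete n)))
  where
  decide : Decidable (λ k → ∃[ H ] Free {3} {n} H Q₀₃ × Is-h H k)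
  decide k = anyHypergraph? (λ H → free? H ×-dec is-h? H)
    λ {G} {H} π (free , is-h) → Free-resp-↭ {G = G} {H} π free , Is-h-resp-↭ {G = G} {H} π is-h
    where
    is-h? : (H : Hypergraph 3 n) → Dec (Is-h H k)
    -- The value h(H) is unique, so it can be computed and compared with `k`.
    is-h? H with h-exists H
    ... | g , is-g = map′ (λ { refl → is-g }) (IsGreatest-unique is-g) (g ℕ.≟ k)

-- The non-edges through vertex zero

module _ {m} (H : Hypergraph 3 (suc m)) (free : Free H Q₀₃) where

  private

    -- The condition `x ≢ y` prevents loops: `tri zero (suc x) (suc x)` has two elements and thus is
    -- never an edge.
    _~_ : Rel (Fin m) 0ℓ
    x ~ y = x ≢ y × tri zero (suc x) (suc y) ∉ˡ edges H

    _~?_ : Decidable₂ _~_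
    x ~? y = ¬? (x ≟ᶠ y) ×-dec ¬? (edge? H (tri zero (suc x) (suc y)))

    ~-sym : Symmetric _~_
    ~-sym {x} {y} (x≢y , 0xy) =
      ≢-sym x≢y , 0xy ∘ subst (_∈ˡ edges H) (tri-swap zero (suc y) (suc x))

    ≁⇒edge : ∀ {x y} → x ≢ y → ¬ (x ~ y) → tri zero (suc x) (suc y) ∈ˡ edges H
    ≁⇒edge x≢y x≁y = decidable-stable (edge? H _) (λ 0xy → x≁y (x≢y , 0xy))

    unique₃ : ∀ {x y z : Fin m} → x ≢ y → x ≢ z → y ≢ z → Unique (suc x ∷ suc y ∷ suc z ∷ [])
    unique₃ xy xz yz = Unique.map⁺ suc-injective ((xy ∷ xz ∷ []) ∷ (yz ∷ []) ∷ [] ∷ [])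

    unique₄ : ∀ {x y z : Fin m} → x ≢ y → x ≢ z → y ≢ z → Unique (zero ∷ suc x ∷ suc y ∷ suc z ∷ [])
    unique₄ xy xz yz = (0≢1+n ∷ 0≢1+n ∷ 0≢1+n ∷ []) ∷ unique₃ xy xz yz

    -- The triples 0xz and 0yz are edges. If xyz were one too, `fourth-face` would make 0xy an edge,
    -- against `x ~ y`.
    edge⇒non-edge : ∀ {x y z} → x ~ y → x ≢ z → y ≢ z → ¬ (x ~ z) → ¬ (y ~ z) →
                    tri (suc x) (suc y) (suc z) ∉ˡ edges H
    edge⇒non-edge (x≢y , 0xy) x≢z y≢z x≁z y≁z xyz =
      0xy (fourth-face H free (unique₄ x≢y x≢z y≢z) (≁⇒edge x≢z x≁z) (≁⇒edge y≢z y≁z) xyz)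

    -- Each triple among the four vertices consists of one of the two graph edges and a vertex
    -- adjacent to neither of its ends. By `edge⇒non-edge` none is an edge of `H`, which
    -- (4,0)-freeness forbids.
    2K₂-free : ∀ {x y z w} → x ~ y → z ~ w →
               ¬ (x ~ z) → ¬ (x ~ w) → ¬ (y ~ z) → ¬ (y ~ w) → Absurd
    2K₂-free {x} {y} {z} {w} x~y z~w x≁z x≁w y≁z y≁w = ¬no-face H free u
      (edge⇒non-edge x~y x≢z y≢z x≁z y≁z)
      (edge⇒non-edge x~y x≢w y≢w x≁w y≁w)
      (edge⇒non-edge z~w (≢-sym x≢z) (≢-sym x≢w) (x≁z ∘ ~-sym) (x≁w ∘ ~-sym)
        ∘ subst (_∈ˡ edges H) (tri-rotate (suc x) (suc z) (suc w)))
      (edge⇒non-edge z~w (≢-sym y≢z) (≢-sym y≢w) (y≁z ∘ ~-sym) (y≁w ∘ ~-sym)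
        ∘ subst (_∈ˡ edges H) (tri-rotate (suc y) (suc z) (suc w)))
      where
      -- A vertex common to both graph edges would make one of them a pair assumed non-adjacent.
      x≢z : x ≢ z
      x≢z refl = x≁w z~w
      x≢w : x ≢ w
      x≢w refl = x≁z (~-sym z~w)
      y≢z : y ≢ z
      y≢z refl = y≁w z~w
      y≢w : y ≢ w
      y≢w refl = y≁z (~-sym z~w)
      u = Unique.map⁺ suc-injective
            ((proj₁ x~y ∷ x≢z ∷ x≢w ∷ []) ∷ (y≢z ∷ y≢w ∷ []) ∷ (proj₁ z~w ∷ []) ∷ [] ∷ [])

    ~-irrefl : ∀ {x} → ¬ (x ~ x)
    ~-irrefl (x≢x , _) = x≢x refl

    cliqueOutsideZero : ∀ {S} →
      (∀ {x y z} → x ∈ S → y ∈ S → z ∈ S → x ≢ y → x ≢ z → y ≢ z →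
        tri (suc x) (suc y) (suc z) ∈ˡ edges H) →
      Clique H (outside ∷ S)
    cliqueOutsideZero tr = clique-fromTriples H λ where
      (there x∈) (there y∈) (there z∈) ((x≢y ∷ x≢z ∷ []) ∷ (y≢z ∷ []) ∷ [] ∷ []) →
        tr x∈ y∈ z∈ (x≢y ∘ cong suc) (x≢z ∘ cong suc) (y≢z ∘ cong suc)

    -- The triples 0xy, 0xz and 0yz are non-edges, so by (4,0)-freeness xyz must be an edge.
    clique⇒clique : ∀ {S} → IsClique _~_ S → Clique H (outside ∷ S)
    clique⇒clique cl = cliqueOutsideZero λ x∈ y∈ z∈ x≢y x≢z y≢z →
      decidable-stable (edge? H _) (¬no-face H free (unique₄ x≢y x≢z y≢z)
        (proj₂ (cl _ _ x∈ y∈ x≢y)) (proj₂ (cl _ _ x∈ z∈ x≢z)) (proj₂ (cl _ _ y∈ z∈ y≢z)))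

    -- The three triples through zero are edges, so xyz is the fourth. Zero is listed last because
    -- `fourth-face` yields the face that omits the last vertex.
    independent⇒clique : ∀ {S} → IsIndependent _~_ S → Clique H (outside ∷ S)
    independent⇒clique ind = cliqueOutsideZero λ x∈ y∈ z∈ x≢y x≢z y≢z →
      fourth-face H free (unique₄′ x≢y x≢z y≢z)
        (edge x≢y (ind _ _ x∈ y∈)) (edge x≢z (ind _ _ x∈ z∈)) (edge y≢z (ind _ _ y∈ z∈))
      where
      edge : ∀ {x y} → x ≢ y → ¬ (x ~ y) → tri (suc x) (suc y) zero ∈ˡ edges H
      edge {x} {y} x≢y x≁y = subst (_∈ˡ edges H) (tri-rotate zero (suc x) (suc y)) (≁⇒edge x≢y x≁y)

      unique₄′ : ∀ {x y z : Fin m} → x ≢ y → x ≢ z → y ≢ z → Unique (suc x ∷ suc y ∷ suc z ∷ zero ∷ [])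
      unique₄′ xy xz yz = Unique.++⁺ (unique₃ xy xz yz) ([] ∷ [])
        λ { (here () , here refl) ; (there (here ()) , here refl) ; (there (there (here ())) , here refl) }

  -- The graph has one vertex fewer than `H`, whence the 1 in the name. Prefixing `outside` keeps
  -- the size of a set, so h(H) bounds both cliques and independent sets of the graph.
  order≤1+h³ : ∀ {k} → Is-h H k → m ≤ k * (k * k)
  order≤1+h³ (_ , max) = 2K₂-free⇒order≤ _~?_ ~-sym ~-irrefl 2K₂-free
    (λ S cl → max _ (outside ∷ S , inj₁ (clique⇒clique cl) , refl))
    (λ S ind → max _ (outside ∷ S , inj₁ (independent⇒clique ind) , refl))

-- Arithmetic of the constant and conclusion

>½·∛ : ∀ n k → n < 8 * (k * (k * k)) → k > ½ ·∛ n
>½·∛ n k n<8k³ = ℚ.toℚᵘ-cancel-< (ℚᵘ.<-respˡ-≃ (ℚᵘ.≃-sym lhs) (ℚᵘ.<-respʳ-≃ (ℚᵘ.≃-sym rhs) mid))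
  where
  ι : ℕ → ℚ
  ι a = ℤ.+ a ℚ./ 1
  -- In unnormalised rationals products are formed without cancelling common factors, so the
  -- comparison reduces to one between integers.
  ιᵘ : ℕ → ℚᵘ.ℚᵘ
  ιᵘ a = ℚᵘ.mkℚᵘ (ℤ.+ a) 0

  toℚᵘ-ι : ∀ a → toℚᵘ (ι a) ℚᵘ.≃ ιᵘ a
  toℚᵘ-ι a = ℚ.toℚᵘ-fromℚᵘ (ιᵘ a)

  lhs : toℚᵘ (½ ℚ.* ½ ℚ.* ½ ℚ.* ι n) ℚᵘ.≃ toℚᵘ (½ ℚ.* ½ ℚ.* ½) ℚᵘ.* ιᵘ n
  lhs = ℚᵘ.≃-trans (ℚ.toℚᵘ-homo-* (½ ℚ.* ½ ℚ.* ½) (ι n)) (ℚᵘ.*-congˡ (toℚᵘ-ι n))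

  rhs : toℚᵘ (ι k ℚ.* ι k ℚ.* ι k) ℚᵘ.≃ ιᵘ k ℚᵘ.* ιᵘ k ℚᵘ.* ιᵘ k
  rhs = ℚᵘ.≃-trans (ℚ.toℚᵘ-homo-* (ι k ℚ.* ι k) (ι k))
       (ℚᵘ.*-cong (ℚᵘ.≃-trans (ℚ.toℚᵘ-homo-* (ι k) (ι k)) (ℚᵘ.*-cong (toℚᵘ-ι k) (toℚᵘ-ι k))) (toℚᵘ-ι k))

  mid : toℚᵘ (½ ℚ.* ½ ℚ.* ½) ℚᵘ.* ιᵘ n ℚᵘ.< ιᵘ k ℚᵘ.* ιᵘ k ℚᵘ.* ιᵘ k
  -- The cube of `½` is 1/8; cross-multiplying leaves n < 8k³.
  mid = ℚᵘ.*<* (ℤ.≤-<-trans (ℤ.≤-reflexive num) (ℤ.<-≤-trans (ℤ.+<+ n<8k³) (ℤ.≤-reflexive den)))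
    where
    num : ℤ.+ 1 ℤ.* ℤ.+ n ℤ.* ℤ.+ 1 ≡ ℤ.+ n
    num = trans (ℤ.*-identityʳ _) (ℤ.*-identityˡ (ℤ.+ n))

    den : ℤ.+ (8 * (k * (k * k))) ≡ ℤ.+ k ℤ.* ℤ.+ k ℤ.* ℤ.+ k ℤ.* ℤ.+ 8
    den = begin
      ℤ.+ (8 * (k * (k * k)))                ≡⟨ cong ℤ.+_ (ℕ.*-comm 8 (k * (k * k))) ⟩
      ℤ.+ (k * (k * k) * 8)                  ≡⟨ cong (λ x → ℤ.+ (x * 8)) (ℕ.*-assoc k k k) ⟨
      ℤ.+ (k * k * k * 8)                    ≡⟨ ℤ.pos-* (k * k * k) 8 ⟩
      ℤ.+ (k * k * k) ℤ.* ℤ.+ 8              ≡⟨ cong (ℤ._* ℤ.+ 8) (ℤ.pos-* (k * k) k) ⟩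
      ℤ.+ (k * k) ℤ.* ℤ.+ k ℤ.* ℤ.+ 8        ≡⟨ cong (λ x → x ℤ.* ℤ.+ k ℤ.* ℤ.+ 8) (ℤ.pos-* k k) ⟩
      ℤ.+ k ℤ.* ℤ.+ k ℤ.* ℤ.+ k ℤ.* ℤ.+ 8    ∎
      where open ≡-Reasoning

-- From 1 < m follows 1 + m < 2m. With k³ for `n`, this turns the bound on the order of the graph
-- into the inequality for the constant `½`.
1+m<8n : ∀ {m n} → 5 ≤ m → m ≤ n → suc m < 8 * n
1+m<8n {m} {n} 5≤m m≤n = begin-strict
  suc m  <⟨ ℕ.+-monoˡ-< m (ℕ.≤-trans (s≤s (s≤s z≤n)) 5≤m) ⟩
  m + m  ≡⟨ cong (m +_) (ℕ.+-identityʳ m) ⟨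
  2 * m  ≤⟨ ℕ.*-mono-≤ {2} {8} (s≤s (s≤s z≤n)) m≤n ⟩
  8 * n  ∎
  where open ℕ.≤-Reasoning

mainTheorem5 : ∃[ c₁ ] c₁ >ℚ 0ℚ × (∀ n → n > 5 →
    ∃[ k ] Is-hᵣ 3 n (｛ 4 , 0 ｝ ∪ ｛ 4 , 3 ｝) k × k > c₁ ·∛ n)
mainTheorem5 = ½ , ℚ.positive⁻¹ ½ , λ where
  (suc m) (s≤s 5≤m) → case h₃-exists (suc m) of λ where
    -- The minimum is attained by some `H`, so the bound for this one hypergraph suffices.
    (k , is-h₃@((H , free , is-h) , _)) →
      k , is-h₃ , >½·∛ (suc m) k (1+m<8n 5≤m (order≤1+h³ H free is-h))
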